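{- The proof system $\mathsf{SDELKh}$ is complete over the class of all models: for every formula $\varphi\in\mathbf{DELKh}$, if $M,w\vDash\varphi$ for every model $M$ and every world $w$ of $M$, then $\varphi$ is provable in $\mathsf{SDELKh}$.
   Context: Fix a countable set $\mathbf{P}$ of proposition letters. $\mathbf{PL}$: $\alpha::=p\mid\bot\mid(\alpha\land\alpha)\mid(\alpha\lor\alpha)\mid(\alpha\to\alpha)$, $p\in\mathbf{P}$. $\mathbf{DELKh}$: $\varphi::=p\mid\bot\mid(\varphi\land\varphi)\mid(\varphi\lor\varphi)\mid(\varphi\to\varphi)\mid\mathsf{K}\varphi\mid\mathsf{Kh}\alpha\mid\Box\varphi$, with $p\in\mathbf{P}$, $\alpha\in\mathbf{PL}$. Abbreviations: $\neg\varphi:=\varphi\to\bot$, $\varphi\leftrightarrow\psi:=(\varphi\to\psi)\land(\psi\to\varphi)$, $\widehat{\mathsf{K}}:=\neg\mathsf{K}\neg$, $\Diamond:=\neg\Box\neg$. A model (epistemic model) is $M=\langle W,V\rangle$ with $W\ne\varnothing$ and $V:W\to\wp(\mathbf{P})$. A submodel of $M$ is $\langle W',V|_{W'}\rangle$ with $\varnothing\ne W'\subseteq W$. Resolution space: $S(p)=\{p\}$; $S(\bot)=\{\bot\}$; $S(\alpha\lor\beta)=(S(\alpha)\times\{0\})\cup(S(\beta)\times\{1\})$; $S(\alpha\land\beta)=S(\alpha)\times S(\beta)$; $S(\alpha\to\beta)=S(\beta)^{S(\alpha)}$. Resolutions at $w\in W$: $R(w,\bot)=\varnothing$; $R(w,p)=\{p\}$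 if $p\in V(w)$, else $\varnothing$; $R(w,\alpha\lor\beta)=(R(w,\alpha)\times\{0\})\cup(R(w,\beta)\times\{1\})$; $R(w,\alpha\land\beta)=R(w,\alpha)\times R(w,\beta)$; $R(w,\alpha\to\beta)=\{f\in S(\beta)^{S(\alpha)}\mid f[R(w,\alpha)]\subseteq R(w,\beta)\}$. Satisfaction $M,w\vDash\varphi$: $M,w\nvDash\bot$; $M,w\vDash p$ iff $p\in V(w)$; $\land,\lor,\to$ are classical; $M,w\vDash\Box\varphi$ iff $M',w\vDash\varphi$ for every submodel $M'$ of $M$ containing $w$; $M,w\vDash\mathsf{K}\varphi$ iff $M,v\vDash\varphi$ for all $v\in W$; $M,w\vDash\mathsf{Kh}\alpha$ iff there is $x\in S(\alpha)$ with $x\in R(v,\alpha)$ for all $v\in W$. System $\mathsf{SDELKh}$ ($p\in\mathbf{P}$; $\alpha,\beta,\alpha_i\in\mathbf{PL}$; $\varphi,\psi\in\mathbf{DELKh}$). Axioms: all (instances in $\mathbf{DELKh}$ of) propositional tautologies; $\mathsf{K}(\varphi\to\psi)\to(\mathsf{K}\varphi\to\mathsf{K}\psi)$; $\mathsf{K}\varphi\to\varphi$; $\mathsf{K}\varphi\to\mathsf{K}\mathsf{K}\varphi$; $\neg\mathsf{K}\varphi\to\mathsf{K}\neg\mathsf{K}\varphi$; $\Box(\varphi\to\psi)\to(\Box\varphi\to\Box\psi)$; $\Box\varphi\to\varphi$; $\Box\varphi\to\Box\Box\varphi$; $\mathsf{K}\Box\varphi\to\Box\mathsf{K}\varphi$;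 $\alpha\to\Box\alpha$; $\alpha\to\Diamond\mathsf{Kh}\alpha$; $\mathsf{Kh}\alpha\to\mathsf{K}\alpha$; $\mathsf{K}p\to\mathsf{Kh}p$; $\mathsf{Kh}\bot\leftrightarrow\bot$; $\mathsf{Kh}(\alpha\lor\beta)\leftrightarrow\mathsf{Kh}\alpha\lor\mathsf{Kh}\beta$; $\mathsf{Kh}(\alpha\land\beta)\leftrightarrow\mathsf{Kh}\alpha\land\mathsf{Kh}\beta$; $\mathsf{Kh}(\alpha\to\beta)\leftrightarrow\mathsf{K}\Box(\mathsf{Kh}\alpha\to\mathsf{Kh}\beta)$; $\mathsf{Kh}\alpha\to\mathsf{K}\mathsf{Kh}\alpha$; $\neg\mathsf{Kh}\alpha\to\mathsf{K}\neg\mathsf{Kh}\alpha$; and for each $k\in\mathbb{N}$, $\alpha\land\bigwedge_{1\le i\le k}\widehat{\mathsf{K}}(\alpha\land\alpha_i)\to\Diamond(\mathsf{K}\alpha\land\bigwedge_{1\le i\le k}\widehat{\mathsf{K}}\alpha_i)$. Rules: modus ponens; from $\vdash\varphi$ infer $\vdash\mathsf{K}\varphi$; from $\vdash\varphi$ infer $\vdash\Box\varphi$. -}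

module Defs where

open import Data.Bool.Base as Bool using (Bool; true; false; T; not)
open import Data.Empty using (⊥)
open import Data.Irrelevant using ([_])
open import Data.List.Base using (List; foldr; map)
open import Data.Nat.Base using (ℕ)
open import Data.Product.Base using (_×_; _,_; ∃-syntax)
open import Data.Refinement using (Refinement-syntax; value; _,_)
open import Data.Sum.Base using (_⊎_; inj₁; inj₂)
open import Data.Unit.Base using (⊤)
open import Function.Bundles using (_↣_)
open import Level using (Lift; 0ℓ; suc)
open import Relation.Binary.PropositionalEquality.Core using (_≡_)
open import Relation.Nullary.Negation.Core using (¬_)
open import Relation.Unary using (Pred; _∈_)

private
  variable
    P X : Set

-- At most countable: finite sets of letters are allowed.
Countable : Set → Set
Countable P = P ↣ ℕ

infixr 9 K_ Kh_ □_ K̂_ ◇_ ~_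
infixr 8 _∧_
infixr 7 _∨_
infixr 6 _⇒_
infix  5 _⇔_

data PL (X : Set) : Set where
  atom        : X → PL X
  bot         : PL X
  _∧_ _∨_ _⇒_ : PL X → PL X → PL X

data DELKh (P : Set) : Set where
  atom        : P → DELKh P
  bot         : DELKh P
  _∧_ _∨_ _⇒_ : DELKh P → DELKh P → DELKh P
  K_          : DELKh P → DELKh P
  Kh_         : PL P → DELKh P
  □_          : DELKh P → DELKh P

~_ : DELKh P → DELKh P
~ φ = φ ⇒ bot

_⇔_ : DELKh P → DELKh P → DELKh P
φ ⇔ ψ = (φ ⇒ ψ) ∧ (ψ ⇒ φ)

K̂_ : DELKh P → DELKh P
K̂ φ = ~ K ~ φ

◇_ : DELKh P → DELKh P
◇ φ = ~ □ ~ φ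

-- The empty conjunction is ¬⊥.
⋀ : List (DELKh P) → DELKh P
⋀ = foldr _∧_ (~ bot)

_⟦_⟧ : PL X → (X → DELKh P) → DELKh P
atom x  ⟦ σ ⟧ = σ x
bot     ⟦ σ ⟧ = bot
(α ∧ β) ⟦ σ ⟧ = (α ⟦ σ ⟧) ∧ (β ⟦ σ ⟧)
(α ∨ β) ⟦ σ ⟧ = (α ⟦ σ ⟧) ∨ (β ⟦ σ ⟧)
(α ⇒ β) ⟦ σ ⟧ = (α ⟦ σ ⟧) ⇒ (β ⟦ σ ⟧)

⌜_⌝ : PL P → DELKh P
⌜ α ⌝ = α ⟦ atom ⟧

eval : (X → Bool) → PL X → Bool
eval ρ (atom x) = ρ x
eval ρ bot      = false
eval ρ (α ∧ β)  = eval ρ α Bool.∧ eval ρ β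
eval ρ (α ∨ β)  = eval ρ α Bool.∨ eval ρ β
eval ρ (α ⇒ β)  = not (eval ρ α) Bool.∨ eval ρ β

Tautology : PL X → Set
Tautology α = ∀ ρ → eval ρ α ≡ true

-- `nonempty` is irrelevant so that models differing only in the chosen
-- inhabitant are definitionally equal.
record Model (P : Set) : Set₁ where
  field
    World     : Set
    .nonempty : World
    V         : World → P → Bool

open Model public using (World; V)

-- Refinement types make membership in U proof-irrelevant, so that the
-- worlds of M ↾[ U , u ] are exactly the elements of U, without repetition.
_↾[_,_] : (M : Model P) (U : Pred (World M) 0ℓ) {w : World M} →
          w ∈ U → Model P
_↾[_,_] M U {w} w∈U = record
  { World    = [ v ∈ World M ∣ v ∈ U ]
  ; nonempty = w , [ w∈U ]
  ; V        = λ v → V M (value v)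
  }

-- The singletons {p} and {⊥} are rendered as ⊤.
S : PL P → Set
S (atom p) = ⊤
S bot      = ⊤
S (α ∧ β)  = S α × S β
S (α ∨ β)  = S α ⊎ S β
S (α ⇒ β)  = S α → S β

R : (M : Model P) → World M → (α : PL P) → Pred (S α) 0ℓ
R M w (atom p) _        = T (V M w p)
R M w bot      _        = ⊥
R M w (α ∧ β)  (x , y)  = x ∈ R M w α × y ∈ R M w β
R M w (α ∨ β)  (inj₁ x) = x ∈ R M w α
R M w (α ∨ β)  (inj₂ y) = y ∈ R M w β
R M w (α ⇒ β)  f        = ∀ x → x ∈ R M w α → f x ∈ R M w β

-- The metatheory of the logic is classical.  Its disjunction and its
-- existential quantifier (for Kh) are therefore the classical ones, i.e. the
-- double negations of _⊎_ and ∃; with excluded middle the ¬ ¬ can be erased.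
-- The remaining clauses need no change, because valuations are two-valued.
infix 3 _,_⊨_

_,_⊨_ : (M : Model P) → World M → DELKh P → Set₁
M , w ⊨ atom p  = Lift (suc 0ℓ) (T (V M w p))
M , w ⊨ bot     = Lift (suc 0ℓ) ⊥
M , w ⊨ (φ ∧ ψ) = (M , w ⊨ φ) × (M , w ⊨ ψ)
M , w ⊨ (φ ∨ ψ) = ¬ ¬ ((M , w ⊨ φ) ⊎ (M , w ⊨ ψ))
M , w ⊨ (φ ⇒ ψ) = (M , w ⊨ φ) → (M , w ⊨ ψ)
M , w ⊨ (K φ)   = ∀ v → M , v ⊨ φ
M , w ⊨ (Kh α)  = Lift (suc 0ℓ) (¬ ¬ (∃[ x ] ∀ v → x ∈ R M v α))
M , w ⊨ (□ φ)   = ∀ (U : Pred (World M) 0ℓ) (w∈U : w ∈ U) →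
                  M ↾[ U , w∈U ] , (w , [ w∈U ]) ⊨ φ

infix 3 ⊢_

data ⊢_ {P : Set} : DELKh P → Set where
  -- ℕ supplies the schematic letters, since P may be too small.
  taut   : (τ : PL ℕ) → Tautology τ → (σ : ℕ → DELKh P) → ⊢ τ ⟦ σ ⟧

  distK  : ∀ φ ψ → ⊢ K (φ ⇒ ψ) ⇒ (K φ ⇒ K ψ)
  TK     : ∀ φ → ⊢ K φ ⇒ φ
  4K     : ∀ φ → ⊢ K φ ⇒ K K φ
  5K     : ∀ φ → ⊢ ~ K φ ⇒ K ~ K φ

  dist□  : ∀ φ ψ → ⊢ □ (φ ⇒ ψ) ⇒ (□ φ ⇒ □ ψ)
  T□     : ∀ φ → ⊢ □ φ ⇒ φ
  4□     : ∀ φ → ⊢ □ φ ⇒ □ □ φ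

  K□     : ∀ φ → ⊢ K □ φ ⇒ □ K φ
  pers   : ∀ α → ⊢ ⌜ α ⌝ ⇒ □ ⌜ α ⌝
  ◇Kh    : ∀ α → ⊢ ⌜ α ⌝ ⇒ ◇ Kh α

  KhK    : ∀ α → ⊢ Kh α ⇒ K ⌜ α ⌝
  KKhp   : ∀ p → ⊢ K (atom p) ⇒ Kh (atom p)
  Kh⊥    : ⊢ Kh bot ⇔ bot
  Kh∨    : ∀ α β → ⊢ Kh (α ∨ β) ⇔ Kh α ∨ Kh β
  Kh∧    : ∀ α β → ⊢ Kh (α ∧ β) ⇔ Kh α ∧ Kh β
  Kh⇒    : ∀ α β → ⊢ Kh (α ⇒ β) ⇔ K □ (Kh α ⇒ Kh β)
  4Kh    : ∀ α → ⊢ Kh α ⇒ K Kh α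
  5Kh    : ∀ α → ⊢ ~ Kh α ⇒ K ~ Kh α

  ◇K     : ∀ α (αs : List (PL P)) →
           ⊢ ⌜ α ⌝ ∧ ⋀ (map (λ αᵢ → K̂ (⌜ α ⌝ ∧ ⌜ αᵢ ⌝)) αs)
             ⇒ ◇ (K ⌜ α ⌝ ∧ ⋀ (map (λ αᵢ → K̂ ⌜ αᵢ ⌝) αs))

  mp     : ∀ {φ ψ} → ⊢ φ ⇒ ψ → ⊢ φ → ⊢ ψ
  necK   : ∀ {φ} → ⊢ φ → ⊢ K φ
  nec□   : ∀ {φ} → ⊢ φ → ⊢ □ φ

{-# OPTIONS --safe #-}
module Submission where

-- Over the finitely many letters of φ a pointed model is determined, up to
-- bisimilarity, by a set X of valuations and a point w ∈ X, and the formula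
--   χ(X,w) = ⋀_{v∈X} K̂ v̂ ∧ K ⋁_{v∈X} v̂ ∧ ŵ
-- (v̂ the conjunction of literals true at v) provably settles every formula in
-- these letters: introspection handles K, persistence and ◇K handle □, and the
-- reduction axioms turn Kh into support in the sense of inquisitive logic.  The
-- disjunction of all χ(X,w) is provable, so a formula refuted by no χ(X,w) is
-- provable.  Truth at (X,w) is decidable, which makes the argument constructive.

open import Defs

open import Data.Bool.Base using (Bool; true; false; T; if_then_else_)
open import Data.Bool.Properties using (T?)
open import Data.Empty using (⊥; ⊥-elim)
open import Data.Fin.Base using (Fin; zero; suc; finToFun; funToFin)
open import Data.Fin.Properties using (any?; all?; finToFun-funToFin; sequence; 2↔Bool)
open import Data.Fin.Subset as Subset using (Subset; _∈_; _∉_; _⊆_; _∩_)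
open import Data.Fin.Subset.Properties using
  (_∈?_; _⊆?_; anySubset?; ∈⊤; ∉⊥; x∈p∩q⁺; x∈p∩q⁻; p∩q⊆p; p∩q⊆q; x∈∁p⇒x∉p; x∉p⇒x∈∁p)
open import Data.Irrelevant using ([_])
open import Data.List.Base using (List; []; _∷_; _++_; map; foldr; filter; allFin; length; lookup)
open import Data.List.Membership.Propositional renaming (_∈_ to _∈ˡ_) using ()
open import Data.List.Membership.Propositional.Properties using
  (∈-map⁺; ∈-map⁻; ∈-filter⁺; ∈-filter⁻; ∈-allFin)
open import Data.List.Relation.Unary.All as All using (All)
open import Data.List.Relation.Unary.All.Properties using (++⁻ˡ; ++⁻ʳ)
open import Data.List.Relation.Unary.Any using (here; there; index)
open import Data.List.Relation.Unary.Any.Properties using (lookup-index)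
open import Data.Nat.Base using (ℕ; zero; suc; _^_)
open import Data.Nat.Properties using () renaming (_≟_ to _≟ℕ_)
open import Data.Product.Base using (_×_; _,_; proj₁; proj₂; ∃; ∃-syntax)
open import Data.Refinement using (Refinement; value; _,_)
open import Data.Sum.Base using (_⊎_; inj₁; inj₂)
open import Data.Unit.Base using (tt)
open import Data.Vec.Base using ([]; _∷_; tabulate; here; there)
open import Data.Vec.Properties using (lookup∘tabulate; lookup⇒[]=; []=⇒lookup)
open import Effect.Monad using (RawMonad)
open import Function.Base using (_∘_; id)
open import Function.Bundles using (Inverse)
open import Level using (lift; lower; 0ℓ)
open import Relation.Binary.Definitions using (DecidableEquality)
open import Relation.Binary.PropositionalEquality using (_≡_; refl; sym; trans; cong; cong₂; subst)
open import Relation.Nullary using (¬_; Dec; yes; no; does; contradiction)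
open import Relation.Nullary.Decidable using
  (_×-dec_; _⊎-dec_; _→-dec_; ¬?; map′; dec-true; decidable-stable; ¬¬-excluded-middle; recompute;
   via-injection)
open import Relation.Nullary.Negation using (¬¬-Monad; ¬¬-map)

private
  variable
    P I : Set
    n : ℕ
    α β : PL P
    γ φ ψ χ : DELKh P

-- Derived rules of the propositional calculus

infix 3 _⊩_
_⊩_ : DELKh P → DELKh P → Set
γ ⊩ φ = ⊢ γ ⇒ φ

schema : DELKh P → DELKh P → DELKh P → ℕ → DELKh P
schema φ ψ χ 0 = φ
schema φ ψ χ 1 = ψ
schema φ ψ χ _ = χ

ax-K : ⊢ φ ⇒ ψ ⇒ φ
ax-K {φ = φ} {ψ = ψ} = taut (atom 0 ⇒ atom 1 ⇒ atom 0) valid (schema φ ψ bot)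
  where
  valid : Tautology (atom 0 ⇒ atom 1 ⇒ atom 0)
  valid ρ with ρ 0 | ρ 1
  ... | false | _ = refl
  ... | true  | false = refl
  ... | true  | true = refl

ax-S : ⊢ (φ ⇒ ψ ⇒ χ) ⇒ (φ ⇒ ψ) ⇒ φ ⇒ χ
ax-S {φ = φ} {ψ = ψ} {χ = χ} =
  taut ((atom 0 ⇒ atom 1 ⇒ atom 2) ⇒ (atom 0 ⇒ atom 1) ⇒ atom 0 ⇒ atom 2) valid (schema φ ψ χ)
  where
  valid : Tautology ((atom 0 ⇒ atom 1 ⇒ atom 2) ⇒ (atom 0 ⇒ atom 1) ⇒ atom 0 ⇒ atom 2)
  valid ρ with ρ 0 | ρ 1 | ρ 2
  ... | false | _     | _ = refl
  ... | true  | false | _ = refl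
  ... | true  | true  | false = refl
  ... | true  | true  | true = refl

fst : φ ∧ ψ ⊩ φ
fst {φ = φ} {ψ = ψ} = taut (atom 0 ∧ atom 1 ⇒ atom 0) valid (schema φ ψ bot)
  where
  valid : Tautology (atom 0 ∧ atom 1 ⇒ atom 0)
  valid ρ with ρ 0 | ρ 1
  ... | false | _ = refl
  ... | true  | false = refl
  ... | true  | true = refl

snd : φ ∧ ψ ⊩ ψ
snd {φ = φ} {ψ = ψ} = taut (atom 0 ∧ atom 1 ⇒ atom 1) valid (schema φ ψ bot)
  where
  valid : Tautology (atom 0 ∧ atom 1 ⇒ atom 1)
  valid ρ with ρ 0 | ρ 1
  ... | false | _ = refl
  ... | true  | false = refl
  ... | true  | true = refl

pair : φ ⊩ ψ ⇒ φ ∧ ψ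
pair {φ = φ} {ψ = ψ} = taut (atom 0 ⇒ atom 1 ⇒ atom 0 ∧ atom 1) valid (schema φ ψ bot)
  where
  valid : Tautology (atom 0 ⇒ atom 1 ⇒ atom 0 ∧ atom 1)
  valid ρ with ρ 0 | ρ 1
  ... | false | _ = refl
  ... | true  | false = refl
  ... | true  | true = refl

inl : φ ⊩ φ ∨ ψ
inl {φ = φ} {ψ = ψ} = taut (atom 0 ⇒ atom 0 ∨ atom 1) valid (schema φ ψ bot)
  where
  valid : Tautology (atom 0 ⇒ atom 0 ∨ atom 1)
  valid ρ with ρ 0
  ... | false = refl
  ... | true = refl

inr : ψ ⊩ φ ∨ ψ
inr {ψ = ψ} {φ = φ} = taut (atom 1 ⇒ atom 0 ∨ atom 1) valid (schema φ ψ bot)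
  where
  valid : Tautology (atom 1 ⇒ atom 0 ∨ atom 1)
  valid ρ with ρ 0 | ρ 1
  ... | _     | false = refl
  ... | false | true = refl
  ... | true  | true = refl

copair : φ ⇒ χ ⊩ (ψ ⇒ χ) ⇒ φ ∨ ψ ⇒ χ
copair {φ = φ} {χ = χ} {ψ = ψ} =
  taut ((atom 0 ⇒ atom 2) ⇒ (atom 1 ⇒ atom 2) ⇒ atom 0 ∨ atom 1 ⇒ atom 2) valid (schema φ ψ χ)
  where
  valid : Tautology ((atom 0 ⇒ atom 2) ⇒ (atom 1 ⇒ atom 2) ⇒ atom 0 ∨ atom 1 ⇒ atom 2)
  valid ρ with ρ 0 | ρ 1 | ρ 2
  ... | false | false | _ = refl
  ... | false | true  | false = refl
  ... | false | true  | true = refl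
  ... | true  | _     | false = refl
  ... | true  | false | true = refl
  ... | true  | true  | true = refl

dne : ~ ~ φ ⊩ φ
dne {φ = φ} = taut (((atom 0 ⇒ bot) ⇒ bot) ⇒ atom 0) valid (schema φ bot bot)
  where
  valid : Tautology (((atom 0 ⇒ bot) ⇒ bot) ⇒ atom 0)
  valid ρ with ρ 0
  ... | false = refl
  ... | true = refl

const : ⊢ φ → γ ⊩ φ
const = mp ax-K

app : γ ⊩ φ ⇒ ψ → γ ⊩ φ → γ ⊩ ψ
app f x = mp (mp ax-S f) x

hyp : φ ⊩ φ
-- The combinator SKK; unification leaves the intermediate formula `bot ⇒ φ` open.
hyp {φ = φ} = app {φ = bot ⇒ φ} ax-K ax-K

infixr 5 _∙_
_∙_ : φ ⊩ ψ → γ ⊩ φ → γ ⊩ ψ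
f ∙ x = app (const f) x

⟨_,_⟩ : γ ⊩ φ → γ ⊩ ψ → γ ⊩ φ ∧ ψ
⟨ x , y ⟩ = app (pair ∙ x) y

curry : γ ∧ φ ⊩ ψ → γ ⊩ φ ⇒ ψ
curry f = app (app (const ax-S) (const (const f))) pair

uncurry : γ ⊩ φ ⇒ ψ → γ ∧ φ ⊩ ψ
uncurry f = app (f ∙ fst) snd

case : γ ∧ φ ⊩ χ → γ ∧ ψ ⊩ χ → γ ⊩ φ ∨ ψ ⇒ χ
case f g = app (copair ∙ curry f) (curry g)

absurd : bot ⊩ φ
absurd = dne ∙ curry fst

-- Argued by contradiction through `dne`: given `~ χ`, the first premise refutes `φ`, and then the
-- second yields `χ`.
split : γ ∧ φ ⊩ χ → γ ∧ ~ φ ⊩ χ → γ ⊩ χ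
split f g = dne ∙ curry (app snd (g ∙ ⟨ fst , curry (app (snd ∙ fst) (f ∙ ⟨ fst ∙ fst , snd ⟩)) ⟩))

contrapose : φ ⊩ ψ → ~ ψ ⊩ ~ φ
contrapose f = curry (app fst (f ∙ snd))

-- Finite conjunctions, disjunctions and case distinctions

⋀-intro : (f : I → DELKh P) (xs : List I) → (∀ {x} → x ∈ˡ xs → γ ⊩ f x) → γ ⊩ ⋀ (map f xs)
⋀-intro f []       h = const hyp
⋀-intro f (x ∷ xs) h = ⟨ h (here refl) , ⋀-intro f xs (h ∘ there) ⟩

⋀-elim : (f : I → DELKh P) {xs : List I} {x : I} → x ∈ˡ xs → ⋀ (map f xs) ⊩ f x
⋀-elim f (here refl) = fst
⋀-elim f (there x∈)  = ⋀-elim f x∈ ∙ snd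

⋁ : List (PL P) → PL P
⋁ = foldr _∨_ bot

⋁-intro : {αs : List (PL P)} → α ∈ˡ αs → ⌜ α ⌝ ⊩ ⌜ ⋁ αs ⌝
⋁-intro (here refl) = inl
⋁-intro (there α∈)  = inr ∙ ⋁-intro α∈

⋁-elim : (αs : List (PL P)) → (∀ {α} → α ∈ˡ αs → γ ∧ ⌜ α ⌝ ⊩ ψ) → γ ∧ ⌜ ⋁ αs ⌝ ⊩ ψ
⋁-elim []       h = absurd ∙ snd
⋁-elim (α ∷ αs) h = uncurry (case (h (here refl)) (⋁-elim αs (h ∘ there)))

literal : Bool → DELKh P → DELKh P
literal b φ = if b then φ else ~ φ

-- Case distinction on each of finitely many formulas.  The continuation is
-- quantified over contexts γ′ so that no conjunction of literals is needed.
case-all : (f : Fin n → DELKh P) →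
           (∀ (Y : Subset n) {γ′} → γ′ ⊩ γ → (∀ {i} → i ∈ Y → γ′ ⊩ f i) →
              (∀ {i} → i ∉ Y → γ′ ⊩ ~ f i) → γ′ ⊩ ψ) →
           γ ⊩ ψ
case-all {n = zero}  f k = k [] hyp (λ { {()} }) (λ { {()} })
case-all {n = suc n} f k = split
  (case-all (f ∘ suc) λ Y h pos neg → k (true ∷ Y) (fst ∙ h)
    (λ { here → snd ∙ h ; (there i∈Y) → pos i∈Y })
    (λ { {zero} i∉Y → contradiction here i∉Y ; {suc i} i∉Y → neg (i∉Y ∘ there) }))
  (case-all (f ∘ suc) λ Y h pos neg → k (false ∷ Y) (fst ∙ h)
    (λ { (there i∈Y) → pos i∈Y })
    (λ { {zero} i∉Y → snd ∙ h ; {suc i} i∉Y → neg (i∉Y ∘ there) }))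

-- Normal modal reasoning for `K` and `□`

K-map : φ ⊩ ψ → K φ ⊩ K ψ
K-map f = mp (distK _ _) (necK f)

K-∧ : γ ⊩ K φ → γ ⊩ K ψ → γ ⊩ K (φ ∧ ψ)
K-∧ x y = app (distK _ _ ∙ K-map (curry hyp) ∙ x) y

K-⋀ : (f : I → DELKh P) (xs : List I) → (∀ {x} → x ∈ˡ xs → γ ⊩ K f x) → γ ⊩ K ⋀ (map f xs)
K-⋀ f []       h = const (necK hyp)
K-⋀ f (x ∷ xs) h = K-∧ (h (here refl)) (K-⋀ f xs (h ∘ there))

□-map : φ ⊩ ψ → □ φ ⊩ □ ψ
□-map f = mp (dist□ _ _) (nec□ f)

□-∧ : γ ⊩ □ φ → γ ⊩ □ ψ → γ ⊩ □ (φ ∧ ψ)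
□-∧ x y = app (dist□ _ _ ∙ □-map (curry hyp) ∙ x) y

-- Subsets of a finite set and exhaustive search

from-does : ∀ {A : Set} (A? : Dec A) → does A? ≡ true → A
from-does (yes a) _ = a

⟪_⟫ : {Q : Fin n → Set} → (∀ i → Dec (Q i)) → Subset n
⟪ Q? ⟫ = tabulate (does ∘ Q?)

∈-⟪⟫⁺ : {Q : Fin n → Set} (Q? : ∀ i → Dec (Q i)) {i : Fin n} → Q i → i ∈ ⟪ Q? ⟫
∈-⟪⟫⁺ Q? {i} q = lookup⇒[]= i _ (trans (lookup∘tabulate _ i) (dec-true (Q? i) q))

∈-⟪⟫⁻ : {Q : Fin n → Set} (Q? : ∀ i → Dec (Q i)) {i : Fin n} → i ∈ ⟪ Q? ⟫ → Q i
∈-⟪⟫⁻ Q? {i} i∈ = from-does (Q? i) (trans (sym (lookup∘tabulate _ i)) ([]=⇒lookup i∈))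

allSubset? : {Q : Subset n → Set} → (∀ X → Dec (Q X)) → Dec (∀ X → Q X)
allSubset? Q? = map′
  (λ ¬∃¬ X → decidable-stable (Q? X) (λ ¬q → ¬∃¬ (X , ¬q)))
  (λ { ∀q (X , ¬q) → ¬q (∀q X) })
  (¬? (anySubset? (¬? ∘ Q?)))

-- `A` and `B` need not be decidable: later they contain derivations, so the search has to return
-- the evidence it meets.
∀⊎∃-Fin : {A B : Fin n → Set} → (∀ i → A i ⊎ B i) → (∀ i → A i) ⊎ ∃ B
∀⊎∃-Fin {n = zero}  h = inj₁ λ ()
∀⊎∃-Fin {n = suc n} h with h zero | ∀⊎∃-Fin (h ∘ suc)
... | inj₂ b | _            = inj₂ (zero , b)
... | inj₁ a | inj₂ (i , b) = inj₂ (suc i , b)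
... | inj₁ a | inj₁ as      = inj₁ λ { zero → a ; (suc i) → as i }

∀⊎∃-Subset : {A B : Subset n → Set} → (∀ X → A X ⊎ B X) → (∀ X → A X) ⊎ ∃ B
∀⊎∃-Subset {n = zero} h with h []
... | inj₁ a = inj₁ λ { [] → a }
... | inj₂ b = inj₂ ([] , b)
∀⊎∃-Subset {n = suc n} h with ∀⊎∃-Subset (h ∘ (true ∷_)) | ∀⊎∃-Subset (h ∘ (false ∷_))
... | inj₂ (X , b) | _            = inj₂ (true ∷ X , b)
... | inj₁ as      | inj₂ (X , b) = inj₂ (false ∷ X , b)
... | inj₁ as      | inj₁ as′     = inj₁ λ { (true ∷ X) → as X ; (false ∷ X) → as′ X }

-- Letters of formulas and stability of truth

letters : PL P → List P
letters (atom p) = p ∷ []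
letters bot      = []
letters (α ∧ β)  = letters α ++ letters β
letters (α ∨ β)  = letters α ++ letters β
letters (α ⇒ β)  = letters α ++ letters β

lettersᴰ : DELKh P → List P
lettersᴰ (atom p) = p ∷ []
lettersᴰ bot      = []
lettersᴰ (φ ∧ ψ)  = lettersᴰ φ ++ lettersᴰ ψ
lettersᴰ (φ ∨ ψ)  = lettersᴰ φ ++ lettersᴰ ψ
lettersᴰ (φ ⇒ ψ)  = lettersᴰ φ ++ lettersᴰ ψ
lettersᴰ (K φ)    = lettersᴰ φ
lettersᴰ (Kh α)   = letters α
lettersᴰ (□ φ)    = lettersᴰ φ

-- The clauses for `∨` and `Kh` are double negations, valuations are two-valued, and the other
-- clauses preserve stability. Truth in an arbitrary submodel may thus be argued classically.
⊨-stable : ∀ (φ : DELKh P) {M w} → ¬ ¬ (M , w ⊨ φ) → M , w ⊨ φ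
⊨-stable (atom p) ¬¬h = lift (decidable-stable (T? _) (¬¬-map lower ¬¬h))
⊨-stable bot      ¬¬h = lift (¬¬h lower)
⊨-stable (φ ∧ ψ)  ¬¬h = ⊨-stable φ (¬¬-map proj₁ ¬¬h) , ⊨-stable ψ (¬¬-map proj₂ ¬¬h)
⊨-stable (φ ∨ ψ)  ¬¬h ¬h = ¬¬h λ h → h ¬h
⊨-stable (φ ⇒ ψ)  ¬¬h x = ⊨-stable ψ (¬¬-map (λ h → h x) ¬¬h)
⊨-stable (K φ)    ¬¬h v = ⊨-stable φ (¬¬-map (λ h → h v) ¬¬h)
⊨-stable (Kh α)   ¬¬h = lift λ ¬h → ¬¬h λ h → lower h ¬h
⊨-stable (□ φ)    ¬¬h U u = ⊨-stable φ (¬¬-map (λ h → h U u) ¬¬h)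

-- Support and satisfaction over finite sets of valuations

module Finite {P : Set} {N : ℕ} (val : Fin N → P → Bool) where

  private
    variable
      X Y : Subset N
      v w : Fin N

  Supp : Subset N → PL P → Set
  Supp X (atom p) = ∀ v → v ∈ X → T (val v p)
  Supp X bot      = ∀ v → v ∉ X
  Supp X (α ∧ β)  = Supp X α × Supp X β
  Supp X (α ∨ β)  = Supp X α ⊎ Supp X β
  Supp X (α ⇒ β)  = ∀ Y → Y ⊆ X → Supp Y α → Supp Y β

  supp? : ∀ X α → Dec (Supp X α)
  supp? X (atom p) = all? λ v → v ∈? X →-dec T? (val v p)
  supp? X bot      = all? λ v → ¬? (v ∈? X)
  supp? X (α ∧ β)  = supp? X α ×-dec supp? X β
  supp? X (α ∨ β)  = supp? X α ⊎-dec supp? X β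
  supp? X (α ⇒ β)  = allSubset? λ Y → Y ⊆? X →-dec (supp? Y α →-dec supp? Y β)

  supp-⊆ : ∀ α → Y ⊆ X → Supp X α → Supp Y α
  supp-⊆ (atom p) Y⊆X s v v∈Y = s v (Y⊆X v∈Y)
  supp-⊆ bot      Y⊆X s v v∈Y = s v (Y⊆X v∈Y)
  supp-⊆ (α ∧ β)  Y⊆X (s , t) = supp-⊆ α Y⊆X s , supp-⊆ β Y⊆X t
  supp-⊆ (α ∨ β)  Y⊆X (inj₁ s) = inj₁ (supp-⊆ α Y⊆X s)
  supp-⊆ (α ∨ β)  Y⊆X (inj₂ t) = inj₂ (supp-⊆ β Y⊆X t)
  supp-⊆ (α ⇒ β)  Y⊆X s Z Z⊆Y = s Z (Y⊆X ∘ Z⊆Y)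

  supp-empty : ∀ α → (∀ v → v ∉ X) → Supp X α
  supp-empty (atom p) e v v∈X = contradiction v∈X (e v)
  supp-empty bot      e = e
  supp-empty (α ∧ β)  e = supp-empty α e , supp-empty β e
  supp-empty (α ∨ β)  e = inj₁ (supp-empty α e)
  supp-empty (α ⇒ β)  e Y Y⊆X _ = supp-empty β λ v → e v ∘ Y⊆X

  Sat : DELKh P → Subset N → Fin N → Set
  Sat (atom p) X w = T (val w p)
  Sat bot      X w = ⊥
  Sat (φ ∧ ψ)  X w = Sat φ X w × Sat ψ X w
  Sat (φ ∨ ψ)  X w = Sat φ X w ⊎ Sat ψ X w
  Sat (φ ⇒ ψ)  X w = Sat φ X w → Sat ψ X w
  Sat (K φ)    X w = ∀ v → v ∈ X → Sat φ X v
  Sat (Kh α)   X w = Supp X α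
  Sat (□ φ)    X w = ∀ Y → Y ⊆ X × w ∈ Y → Sat φ Y w

  sat? : ∀ φ X w → Dec (Sat φ X w)
  sat? (atom p) X w = T? (val w p)
  sat? bot      X w = no id
  sat? (φ ∧ ψ)  X w = sat? φ X w ×-dec sat? ψ X w
  sat? (φ ∨ ψ)  X w = sat? φ X w ⊎-dec sat? ψ X w
  sat? (φ ⇒ ψ)  X w = sat? φ X w →-dec sat? ψ X w
  sat? (K φ)    X w = all? λ v → v ∈? X →-dec sat? φ X v
  sat? (Kh α)   X w = supp? X α
  sat? (□ φ)    X w = allSubset? λ Y → (Y ⊆? X ×-dec w ∈? Y) →-dec sat? φ Y w

  -- Resolutions and supporting states

  -- S (α ⇒ β) consists of arbitrary functions, which cannot be enumerated;
  -- the maps `realizer` and `scope` between S α and the states supporting α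
  -- take the place of an enumeration.
  realizer : ∀ α → Subset N → S α
  scope    : ∀ α → S α → Subset N

  realizer (atom p) X = tt
  realizer bot      X = tt
  realizer (α ∧ β)  X = realizer α X , realizer β X
  realizer (α ∨ β)  X with supp? X α
  ... | yes _ = inj₁ (realizer α X)
  ... | no  _ = inj₂ (realizer β X)
  -- `scope α x ∩ X` is a substate of `X` supporting `α`, hence also `β` whenever `X` supports the
  -- implication.
  realizer (α ⇒ β)  X x = realizer β (scope α x ∩ X)

  -- A resolution of an implication must respect every `x` in `S α`; here `f` is tested only on
  -- realizers of the finitely many states. The set of worlds passing includes those where `f` is a
  -- resolution, and it still supports the implication.
  in-scope? : ∀ α β (f : S α → S β) v →
              Dec (∀ Y → v ∈ Y → Supp Y α → v ∈ scope β (f (realizer α Y)))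

  scope (atom p) _        = ⟪ (λ v → T? (val v p)) ⟫
  scope bot      _        = Subset.⊥
  scope (α ∧ β)  (x , y)  = scope α x ∩ scope β y
  scope (α ∨ β)  (inj₁ x) = scope α x
  scope (α ∨ β)  (inj₂ y) = scope β y
  scope (α ⇒ β)  f        = ⟪ in-scope? α β f ⟫

  in-scope? α β f v = allSubset? λ Y →
    v ∈? Y →-dec (supp? Y α →-dec v ∈? scope β (f (realizer α Y)))

  supp-scope : ∀ α x → Supp (scope α x) α
  supp-scope (atom p) x v v∈ = ∈-⟪⟫⁻ (λ v → T? (val v p)) v∈
  supp-scope bot      x v    = ∉⊥
  supp-scope (α ∧ β)  (x , y) =
    supp-⊆ α (p∩q⊆p _ _) (supp-scope α x) , supp-⊆ β (p∩q⊆q _ _) (supp-scope β y)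
  supp-scope (α ∨ β)  (inj₁ x) = inj₁ (supp-scope α x)
  supp-scope (α ∨ β)  (inj₂ y) = inj₂ (supp-scope β y)
  -- Every `v` in `Y` passes the test for the state `Y` itself, so `Y` lies in the scope of
  -- `f (realizer α Y)`.
  supp-scope (α ⇒ β)  f Y Y⊆ s =
    supp-⊆ β (λ v∈Y → ∈-⟪⟫⁻ (in-scope? α β f) (Y⊆ v∈Y) Y v∈Y s) (supp-scope β (f (realizer α Y)))

  -- Restricting such a model gives one of the same form definitionally, with `loc ∘ value` as
  -- location, so the induction for `□` stays within this class.
  model : (A : Set) → (A → Fin N) → .A → Model P
  model A loc a = record { World = A ; nonempty = a ; V = λ b → val (loc b) }

  module _ {A : Set} {loc : A → Fin N} .{ne : A} where

    -- Mutual with `realizer-∈R` by the contravariance of `⇒`: to place `f` in scope it is applied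
    -- to realizers, and a realizer of `α ⇒ β` must answer an arbitrary resolution, which is located
    -- by its scope.
    R⇒∈-scope : ∀ α {x a} → R (model A loc ne) a α x → loc a ∈ scope α x

    realizer-∈R : ∀ α {a} → Supp X α → loc a ∈ X → R (model A loc ne) a α (realizer α X)

    R⇒∈-scope (atom p) r = ∈-⟪⟫⁺ (λ v → T? (val v p)) r
    R⇒∈-scope (α ∧ β) (r , s) = x∈p∩q⁺ (R⇒∈-scope α r , R⇒∈-scope β s)
    R⇒∈-scope (α ∨ β) {inj₁ x} r = R⇒∈-scope α r
    R⇒∈-scope (α ∨ β) {inj₂ y} r = R⇒∈-scope β r
    R⇒∈-scope (α ⇒ β) {f} r = ∈-⟪⟫⁺ (in-scope? α β f)
      λ Y a∈Y s → R⇒∈-scope β (r _ (realizer-∈R α s a∈Y))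

    realizer-∈R (atom p) s a∈X = s _ a∈X
    realizer-∈R bot      s a∈X = s _ a∈X
    realizer-∈R (α ∧ β)  (s , t) a∈X = realizer-∈R α s a∈X , realizer-∈R β t a∈X
    realizer-∈R {X = X} (α ∨ β) s a∈X with supp? X α
    realizer-∈R (α ∨ β) _        a∈X | yes s = realizer-∈R α s a∈X
    realizer-∈R (α ∨ β) (inj₁ s) a∈X | no ¬s = contradiction s ¬s
    realizer-∈R (α ∨ β) (inj₂ t) a∈X | no _  = realizer-∈R β t a∈X
    realizer-∈R {X = X} (α ⇒ β) s a∈X x r = realizer-∈R β
      (s (scope α x ∩ X) (p∩q⊆q _ _) (supp-⊆ α (p∩q⊆p _ _) (supp-scope α x)))
      (x∈p∩q⁺ (R⇒∈-scope α r , a∈X))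

  -- Truth lemma: models against sets of valuations

  record Covers {A : Set} (loc : A → Fin N) (X : Subset N) : Set where
    field
      into : ∀ a → loc a ∈ X
      -- Doubly negated, since a submodel is cut out by an arbitrary predicate and no preimage can
      -- be computed.
      onto : ∀ {v} → v ∈ X → ¬ ¬ (∃[ a ] loc a ≡ v)
  open Covers

  -- A model covering `X` is bisimilar to `X`, and submodels match subsets by preimage and image
  -- under `loc`. Double negations are discharged by decidability of `Sat` in this direction and by
  -- stability of truth in the converse.
  truth⇒ : ∀ φ {A loc} .{ne : A} → Covers loc X → ∀ {a} →
           model A loc ne , a ⊨ φ → Sat φ X (loc a)
  truth⇐ : ∀ φ {A loc} .{ne : A} → Covers loc X → ∀ {a} →
           Sat φ X (loc a) → model A loc ne , a ⊨ φ

  truth⇒ (atom p) c h = lower h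
  truth⇒ bot      c h = lower h
  truth⇒ (φ ∧ ψ)  c (h , k) = truth⇒ φ c h , truth⇒ ψ c k
  truth⇒ (φ ∨ ψ)  c h = decidable-stable (sat? (φ ∨ ψ) _ _)
    (λ ¬s → h λ { (inj₁ k) → ¬s (inj₁ (truth⇒ φ c k)) ; (inj₂ k) → ¬s (inj₂ (truth⇒ ψ c k)) })
  truth⇒ (φ ⇒ ψ)  c h s = truth⇒ ψ c (h (truth⇐ φ c s))
  truth⇒ (K φ)    c h v v∈X = decidable-stable (sat? φ _ v)
    (¬¬-map (λ { (a , refl) → truth⇒ φ c (h a) }) (onto c v∈X))
  -- A resolution `x` common to all worlds has the whole of `X` in its scope, and the scope supports
  -- `α`.
  truth⇒ {X = X} (Kh α) c h = decidable-stable (supp? X α)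
    (¬¬-map (λ { (x , r) → supp-⊆ α
      (λ v∈X → decidable-stable (_ ∈? _)
        (¬¬-map (λ { (a , refl) → R⇒∈-scope α (r a) }) (onto c v∈X)))
      (supp-scope α x) }) (lower h))
  truth⇒ (□ φ) {loc = loc} c h Y (Y⊆X , a∈Y) = truth⇒ φ
    (record
      { into = λ { (b , [ b∈Y ]) → recompute (loc b ∈? Y) b∈Y }
      ; onto = λ v∈Y → ¬¬-map (λ { (b , refl) → (b , [ v∈Y ]) , refl }) (onto c (Y⊆X v∈Y)) })
    (h (λ b → loc b ∈ Y) a∈Y)

  truth⇐ (atom p) c s = lift s
  truth⇐ (φ ∧ ψ)  c (s , t) = truth⇐ φ c s , truth⇐ ψ c t
  truth⇐ (φ ∨ ψ)  c (inj₁ s) ¬h = ¬h (inj₁ (truth⇐ φ c s))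
  truth⇐ (φ ∨ ψ)  c (inj₂ t) ¬h = ¬h (inj₂ (truth⇐ ψ c t))
  truth⇐ (φ ⇒ ψ)  c s h = truth⇐ ψ c (s (truth⇒ φ c h))
  truth⇐ (K φ)    c s b = truth⇐ φ c (s _ (into c b))
  truth⇐ {X = X} (Kh α) c s = lift λ ¬∃ → ¬∃ (realizer α X , λ b → realizer-∈R α s (into c b))
  -- The matching subset is the image of `U` under `loc`. Membership in it need not be decidable,
  -- but there are only finitely many `v`, so all decisions hold jointly under a double negation,
  -- which the stable goal absorbs.
  truth⇐ {X = X} (□ φ) {loc = loc} c {a} s U a∈U = ⊨-stable φ λ ¬h →
    sequence rawApplicative (λ v → ¬¬-excluded-middle {A = Image v}) λ Im? → ¬h (truth⇐ φ
      (record
        { into = λ b → ∈-⟪⟫⁺ Im? (b , refl)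
        ; onto = λ v∈Y ¬∃ → ¬∃ (∈-⟪⟫⁻ Im? v∈Y) })
      (s ⟪ Im? ⟫
        ( (λ v∈Y → let (b , eq) = ∈-⟪⟫⁻ Im? v∈Y in subst (_∈ X) eq (into c (value b)))
        , ∈-⟪⟫⁺ Im? ((a , [ a∈U ]) , refl))))
    where
    open RawMonad (¬¬-Monad {a = 0ℓ})
    Image : Fin N → Set
    Image v = ∃ λ (b : Refinement _ U) → loc (value b) ≡ v

  valid⇒Sat : ∀ φ → (∀ (M : Model P) w → M , w ⊨ φ) → w ∈ X → Sat φ X w
  valid⇒Sat {w = w} {X = X} φ valid w∈X = truth⇒ φ {A = ∃ (_∈ X)} {loc = proj₁} {ne = w , w∈X}
    (record { into = proj₂ ; onto = λ v∈X ¬∃ → ¬∃ ((_ , v∈X) , refl) }) (valid _ (w , w∈X))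

  -- Characteristic formulas and modal derivations

  module Decision (char : Fin N → PL P) where

    elems : Subset N → List (Fin N)
    elems X = filter (_∈? X) (allFin N)

    ∈-elems⁺ : v ∈ X → v ∈ˡ elems X
    ∈-elems⁺ v∈X = ∈-filter⁺ (_∈? _) (∈-allFin _) v∈X

    ∈-elems⁻ : v ∈ˡ elems X → v ∈ X
    ∈-elems⁻ v∈ = proj₂ (∈-filter⁻ (_∈? _) {xs = allFin N} v∈)

    chars : Subset N → List (PL P)
    chars X = map char (elems X)

    ∈-chars⁺ : v ∈ X → char v ∈ˡ chars X
    ∈-chars⁺ v∈X = ∈-map⁺ char (∈-elems⁺ v∈X)

    chars-∀ : (Q : PL P → Set) → (∀ v → v ∈ X → Q (char v)) → α ∈ˡ chars X → Q α
    chars-∀ Q h α∈ with ∈-map⁻ char α∈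
    ... | v , v∈ , refl = h v (∈-elems⁻ v∈)

    possible : Subset N → DELKh P
    possible X = ⋀ (map (λ α → K̂ ⌜ α ⌝) (chars X))

    exhaustive : Subset N → DELKh P
    exhaustive X = K ⌜ ⋁ (chars X) ⌝

    -- This is χ(X,w); the part independent of the world is grouped so that `introspect` can carry
    -- it under `K`.
    describe : Subset N → Fin N → DELKh P
    describe X w = (possible X ∧ exhaustive X) ∧ ⌜ char w ⌝

    possible-elim : v ∈ X → possible X ⊩ K̂ ⌜ char v ⌝
    possible-elim v∈X = ⋀-elim (λ α → K̂ ⌜ α ⌝) (∈-chars⁺ v∈X)

    -- The semantic counterpart `A` is a parameter, so that the lemmas for the connectives serve
    -- both `Supp` and `Sat`.
    Verdict : DELKh P → Subset N → Fin N → Set → Set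
    Verdict φ X w A = (A × describe X w ⊩ φ) ⊎ (¬ A × describe X w ⊩ ~ φ)

    -- `K̂` is a negated `K`, so `5K` handles `possible` and `4K` handles `exhaustive`.
    introspect : possible X ∧ exhaustive X ⊩ K (possible X ∧ exhaustive X)
    introspect = K-∧
      (K-⋀ (λ α → K̂ ⌜ α ⌝) (chars _) (λ α∈ → 5K _ ∙ ⋀-elim (λ α → K̂ ⌜ α ⌝) α∈ ∙ fst))
      (4K _ ∙ snd)

    -- Under `K`, `exhaustive X` offers some `char v` with `v ∈ X`, and introspection completes it
    -- to `describe X v`.
    ⊩-K : (∀ v → v ∈ X → describe X v ⊩ φ) → describe X w ⊩ K φ
    ⊩-K {X = X} {φ = φ} h =
      K-map (⋁-elim (chars X) (chars-∀ (λ α → _ ∧ ⌜ α ⌝ ⊩ φ) h)) ∙ K-∧ introspect snd ∙ fst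

    -- If `K φ` held, introspection would give `K ~ ⌜ char v ⌝`, against `possible X`.
    ⊩-¬K : v ∈ X → describe X v ⊩ ~ φ → describe X w ⊩ ~ K φ
    ⊩-¬K v∈X h = curry (app (possible-elim v∈X ∙ fst ∙ fst ∙ fst)
      (K-map (curry (app (h ∙ ⟨ fst ∙ fst , snd ⟩) (snd ∙ fst))) ∙ K-∧ (introspect ∙ fst ∙ fst) snd))

    -- `possible X` may fail after passing to a submodel; the premise retains what persists. Let `Z`
    -- collect the `v` with `K̂ ⌜ char v ⌝`: worlds outside `Z` are excluded under `K`, so
    -- `describe (Z ∩ X) w` holds.
    substates : w ∈ X → (∀ Y → Y ⊆ X × w ∈ Y → describe Y w ⊩ φ) →
                exhaustive X ∧ ⌜ char w ⌝ ⊩ φ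
    substates {w = w} {X = X} {φ = φ} w∈X h = case-all (λ v → K̂ ⌜ char v ⌝) λ Z {γ′} base pos neg →
      let
        impossible : {v : Fin N} → v ∉ Z → γ′ ⊩ K ~ ⌜ char v ⌝
        impossible = λ v∉Z → dne ∙ neg v∉Z

        narrow : γ′ ⊩ exhaustive (Z ∩ X)
        narrow = K-map (⋁-elim (chars X)
          (chars-∀ (λ α → excluded Z ∧ ⌜ α ⌝ ⊩ ⌜ ⋁ (chars (Z ∩ X)) ⌝)
            λ v v∈X → keep Z v v∈X))
          ∙ K-∧ (K-⋀ (λ v → ~ ⌜ char v ⌝) (elems (Subset.∁ Z))
                  (λ v∈ → impossible (x∈∁p⇒x∉p (∈-elems⁻ v∈))))
                (fst ∙ base)
      in conclude Z base pos neg narrow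
      where
      excluded : Subset N → DELKh P
      excluded Z = ⋀ (map (λ v → ~ ⌜ char v ⌝) (elems (Subset.∁ Z)))

      keep : ∀ Z v → v ∈ X → excluded Z ∧ ⌜ char v ⌝ ⊩ ⌜ ⋁ (chars (Z ∩ X)) ⌝
      keep Z v v∈X with v ∈? Z
      ... | yes v∈Z = ⋁-intro (∈-chars⁺ (x∈p∩q⁺ (v∈Z , v∈X))) ∙ snd
      ... | no v∉Z  = absurd ∙ app (⋀-elim (λ v → ~ ⌜ char v ⌝) (∈-elems⁺ (x∉p⇒x∈∁p v∉Z)) ∙ fst) snd

      conclude : ∀ Z {γ′} → γ′ ⊩ exhaustive X ∧ ⌜ char w ⌝ →
                 (∀ {v} → v ∈ Z → γ′ ⊩ K̂ ⌜ char v ⌝) →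
                 (∀ {v} → v ∉ Z → γ′ ⊩ ~ K̂ ⌜ char v ⌝) →
                 γ′ ⊩ exhaustive (Z ∩ X) → γ′ ⊩ φ
      conclude Z base pos neg narrow with w ∈? Z
      -- The actual world is possible: `K ~ ⌜ char w ⌝` contradicts `⌜ char w ⌝` by `TK`.
      ... | no w∉Z  = absurd ∙ app (TK _ ∙ dne ∙ neg w∉Z) (snd ∙ base)
      ... | yes w∈Z = h (Z ∩ X) (p∩q⊆q Z X , x∈p∩q⁺ (w∈Z , w∈X)) ∙
        ⟨ ⟨ ⋀-intro (λ α → K̂ ⌜ α ⌝) (chars (Z ∩ X))
              (chars-∀ (λ α → _ ⊩ K̂ ⌜ α ⌝) λ v v∈ → pos (proj₁ (x∈p∩q⁻ Z X v∈)))
          , narrow ⟩ , snd ∙ base ⟩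

    -- Persistence under `K` followed by `K□` turns `exhaustive X` into its boxed form, and `char w`
    -- persists; `substates` is then applied under `□`.
    ⊩-□ : w ∈ X → (∀ Y → Y ⊆ X × w ∈ Y → describe Y w ⊩ φ) → describe X w ⊩ □ φ
    ⊩-□ {w = w} {X = X} w∈X h = □-map (substates w∈X h) ∙
      □-∧ (K□ _ ∙ K-map (pers (⋁ (chars X))) ∙ snd ∙ fst) (pers (char w) ∙ snd)

    -- This instance of `◇K` yields `◇ (exhaustive Y ∧ possible Y)`. As `char w` persists,
    -- `describe Y w` would hold there and refute `φ`.
    ⊩-¬□ : Y ⊆ X → w ∈ Y → describe Y w ⊩ ~ φ → describe X w ⊩ ~ □ φ
    ⊩-¬□ {Y = Y} {X = X} {w = w} Y⊆X w∈Y h = curry (app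
      (◇K (⋁ (chars Y)) (chars Y) ∙
        ⟨ ⋁-intro (∈-chars⁺ w∈Y) ∙ snd
        , ⋀-intro (λ α → K̂ (⌜ ⋁ (chars Y) ⌝ ∧ ⌜ α ⌝)) (chars Y)
            (chars-∀ (λ α → describe X w ⊩ K̂ (⌜ ⋁ (chars Y) ⌝ ∧ ⌜ α ⌝)) λ v v∈Y →
              contrapose (K-map (contrapose ⟨ ⋁-intro (∈-chars⁺ v∈Y) , hyp ⟩)) ∙
              possible-elim (Y⊆X v∈Y) ∙ fst ∙ fst) ⟩ ∙ fst)
      (□-map (curry (app (h ∙ ⟨ ⟨ snd ∙ snd , fst ∙ snd ⟩ , snd ∙ fst ⟩) (fst ∙ fst))) ∙
        □-∧ snd (pers (char w) ∙ snd ∙ fst)))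

    -- Every formula is settled by the characteristic formulas

    verdict-⇔ : {A B : Set} → ⊢ φ ⇔ ψ → (A → B) → (B → A) → Verdict ψ X w B → Verdict φ X w A
    verdict-⇔ e to from (inj₁ (b , p))  = inj₁ (from b , mp snd e ∙ p)
    verdict-⇔ e to from (inj₂ (¬b , p)) = inj₂ (¬b ∘ to , contrapose (mp fst e) ∙ p)

    verdict-∧ : {A B : Set} → Verdict φ X w A → Verdict ψ X w B → Verdict (φ ∧ ψ) X w (A × B)
    verdict-∧ (inj₁ (a , p))  (inj₁ (b , q))  = inj₁ ((a , b) , ⟨ p , q ⟩)
    verdict-∧ (inj₂ (¬a , p)) _               = inj₂ (¬a ∘ proj₁ , contrapose fst ∙ p)
    verdict-∧ (inj₁ _)        (inj₂ (¬b , q)) = inj₂ (¬b ∘ proj₂ , contrapose snd ∙ q)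

    verdict-∨ : {A B : Set} → Verdict φ X w A → Verdict ψ X w B → Verdict (φ ∨ ψ) X w (A ⊎ B)
    verdict-∨ (inj₁ (a , p))  _               = inj₁ (inj₁ a , inl ∙ p)
    verdict-∨ (inj₂ _)        (inj₁ (b , q))  = inj₁ (inj₂ b , inr ∙ q)
    verdict-∨ (inj₂ (¬a , p)) (inj₂ (¬b , q)) =
      inj₂ ((λ { (inj₁ a) → ¬a a ; (inj₂ b) → ¬b b }) , case (uncurry p) (uncurry q))

    verdict-⇒ : {A B : Set} → Verdict φ X w A → Verdict ψ X w B → Verdict (φ ⇒ ψ) X w (A → B)
    verdict-⇒ (inj₂ (¬a , p)) _               = inj₁ (⊥-elim ∘ ¬a , curry (absurd ∙ uncurry p))
    verdict-⇒ (inj₁ _)        (inj₁ (b , q))  = inj₁ ((λ _ → b) , curry (q ∙ fst))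
    verdict-⇒ (inj₁ (a , p))  (inj₂ (¬b , q)) =
      inj₂ ((λ f → ¬b (f a)) , curry (app (q ∙ fst) (app snd (p ∙ fst))))

    verdict-K : {A : Fin N → Set} → (∀ v → v ∈ X → Verdict φ X v (A v)) →
                Verdict (K φ) X w (∀ v → v ∈ X → A v)
    verdict-K {X = X} {φ = φ} {w = w} {A = A} h = conclude (∀⊎∃-Fin search)
      where
      Holds Fails : Fin N → Set
      Holds v = v ∈ X → A v × describe X v ⊩ φ
      Fails v = v ∈ X × ¬ A v × describe X v ⊩ ~ φ

      search : ∀ v → Holds v ⊎ Fails v
      search v with v ∈? X
      ... | no v∉X  = inj₁ λ v∈X → contradiction v∈X v∉X
      ... | yes v∈X with h v v∈X
      ...   | inj₁ p = inj₁ λ _ → p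
      ...   | inj₂ p = inj₂ (v∈X , p)

      conclude : (∀ v → Holds v) ⊎ ∃ Fails → Verdict (K φ) X w (∀ v → v ∈ X → A v)
      conclude (inj₁ p)                  = inj₁ ((λ v → proj₁ ∘ p v) , ⊩-K (λ v → proj₂ ∘ p v))
      conclude (inj₂ (v , v∈X , ¬a , p)) = inj₂ ((λ a → ¬a (a v v∈X)) , ⊩-¬K v∈X p)

    verdict-□ : {A : Subset N → Set} → w ∈ X → (∀ Y → Y ⊆ X × w ∈ Y → Verdict φ Y w (A Y)) →
                Verdict (□ φ) X w (∀ Y → Y ⊆ X × w ∈ Y → A Y)
    verdict-□ {w = w} {X = X} {φ = φ} {A = A} w∈X h = conclude (∀⊎∃-Subset search)
      where
      Holds Fails : Subset N → Set
      Holds Y = Y ⊆ X × w ∈ Y → A Y × describe Y w ⊩ φ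
      Fails Y = (Y ⊆ X × w ∈ Y) × ¬ A Y × describe Y w ⊩ ~ φ

      search : ∀ Y → Holds Y ⊎ Fails Y
      search Y with Y ⊆? X ×-dec w ∈? Y
      ... | no ¬c  = inj₁ λ c → contradiction c ¬c
      ... | yes c with h Y c
      ...   | inj₁ p = inj₁ λ _ → p
      ...   | inj₂ p = inj₂ (c , p)

      conclude : (∀ Y → Holds Y) ⊎ ∃ Fails → Verdict (□ φ) X w (∀ Y → Y ⊆ X × w ∈ Y → A Y)
      conclude (inj₁ p) = inj₁ ((λ Y → proj₁ ∘ p Y) , ⊩-□ w∈X (λ Y → proj₂ ∘ p Y))
      conclude (inj₂ (Y , (Y⊆X , w∈Y) , ¬a , p)) =
        inj₂ ((λ a → ¬a (a Y (Y⊆X , w∈Y))) , ⊩-¬□ Y⊆X w∈Y p)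

    Describes : P → Set
    Describes p = ∀ v → ⌜ char v ⌝ ⊩ literal (val v p) (atom p)

    verdict-atom : ∀ {p} → Describes p → Verdict (atom p) X w (T (val w p))
    verdict-atom {w = w} {p = p} d with val w p | d w
    ... | true  | l = inj₁ (tt , l ∙ snd)
    ... | false | l = inj₂ (id , l ∙ snd)

    -- Each reduction axiom matches the corresponding clause of `Supp`; for letters, `KhK` and
    -- `KKhp` make `Kh` equivalent to `K`.
    verdict-Kh : ∀ α → All Describes (letters α) → w ∈ X → Verdict (Kh α) X w (Supp X α)
    verdict-Kh (atom p) (d All.∷ _) w∈X =
      verdict-⇔ (mp (mp pair (KhK _)) (KKhp p)) id id (verdict-K λ v _ → verdict-atom d)
    verdict-Kh bot      d w∈X = inj₂ ((λ e → e _ w∈X) , const (mp fst Kh⊥))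
    verdict-Kh (α ∧ β)  d w∈X = verdict-⇔ (Kh∧ α β) id id
      (verdict-∧ (verdict-Kh α (++⁻ˡ _ d) w∈X) (verdict-Kh β (++⁻ʳ (letters α) d) w∈X))
    verdict-Kh (α ∨ β)  d w∈X = verdict-⇔ (Kh∨ α β) id id
      (verdict-∨ (verdict-Kh α (++⁻ˡ _ d) w∈X) (verdict-Kh β (++⁻ʳ (letters α) d) w∈X))
    verdict-Kh {X = X} (α ⇒ β) d w∈X = verdict-⇔ (Kh⇒ α β)
      (λ s v v∈X Y (Y⊆X , v∈Y) → s Y Y⊆X) pointwise
      (verdict-K λ v v∈X → verdict-□ v∈X λ Y (Y⊆X , v∈Y) →
        verdict-⇒ (verdict-Kh α (++⁻ˡ _ d) v∈Y) (verdict-Kh β (++⁻ʳ (letters α) d) v∈Y))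
      where
      pointwise : (∀ v → v ∈ X → ∀ Y → Y ⊆ X × v ∈ Y → Supp Y α → Supp Y β) → Supp X (α ⇒ β)
      pointwise s Y Y⊆X t with any? (_∈? Y)
      ... | yes (v , v∈Y) = s v (Y⊆X v∈Y) Y (Y⊆X , v∈Y) t
      -- `K □` reaches only substates containing some `v`; the empty substate supports `β`
      -- trivially.
      ... | no empty      = supp-empty β λ v v∈Y → empty (v , v∈Y)

    verdict : ∀ φ → All Describes (lettersᴰ φ) → w ∈ X → Verdict φ X w (Sat φ X w)
    verdict (atom p) (d All.∷ _) w∈X = verdict-atom d
    verdict bot      d w∈X = inj₂ (id , const hyp)
    verdict (φ ∧ ψ)  d w∈X =
      verdict-∧ (verdict φ (++⁻ˡ _ d) w∈X) (verdict ψ (++⁻ʳ (lettersᴰ φ) d) w∈X)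
    verdict (φ ∨ ψ)  d w∈X =
      verdict-∨ (verdict φ (++⁻ˡ _ d) w∈X) (verdict ψ (++⁻ʳ (lettersᴰ φ) d) w∈X)
    verdict (φ ⇒ ψ)  d w∈X =
      verdict-⇒ (verdict φ (++⁻ˡ _ d) w∈X) (verdict ψ (++⁻ʳ (lettersᴰ φ) d) w∈X)
    verdict (K φ)    d w∈X = verdict-K λ v → verdict φ d
    verdict (Kh α)   d w∈X = verdict-Kh α d w∈X
    verdict (□ φ)    d w∈X = verdict-□ w∈X λ Y (_ , w∈Y) → verdict φ d w∈Y

    -- By `cases` and necessitation `exhaustive` of the full set is provable, so `substates` reduces
    -- `φ` to its derivability from every `describe Y v`, where validity rules out a negative
    -- verdict.
    complete : (∀ {φ ψ} → (∀ v → ψ ∧ ⌜ char v ⌝ ⊩ φ) → ψ ⊩ φ) → ∀ φ → All Describes (lettersᴰ φ) →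
               (∀ (M : Model P) w → M , w ⊨ φ) → ⊢ φ
    complete cases φ d valid = mp (cases λ v → substates ∈⊤ (λ Y (_ , v∈Y) → holds Y v v∈Y) ∙
      ⟨ const (necK (mp (cases λ w → ⋁-intro (∈-chars⁺ ∈⊤) ∙ snd) truth)) , snd ⟩) truth
      where
      truth : ⊢ ~ bot
      truth = hyp

      holds : ∀ Y v → v ∈ Y → describe Y v ⊩ φ
      holds Y v v∈Y with verdict φ d v∈Y
      ... | inj₁ (_ , p)  = p
      ... | inj₂ (¬s , _) = contradiction (valid⇒Sat φ valid v∈Y) ¬s

-- Valuations of a finite list of letters as worlds

module Valuations {P : Set} (_≟_ : DecidableEquality P) (Q : List P) where

  private
    World′ : Set
    World′ = Fin (2 ^ length Q)

  bit : World′ → Fin (length Q) → Bool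
  bit w i = Inverse.to 2↔Bool (finToFun w i)

  encode : (Fin (length Q) → Bool) → World′
  encode b = funToFin (Inverse.from 2↔Bool ∘ b)

  bit-encode : ∀ b i → bit (encode b) i ≡ b i
  bit-encode b i = trans (cong (Inverse.to 2↔Bool) (finToFun-funToFin (Inverse.from 2↔Bool ∘ b) i))
    (Inverse.strictlyInverseˡ 2↔Bool (b i))

  -- Q may list a letter several times; the valuation goes by one occurrence,
  -- and a world whose bits disagree has an inconsistent `char`.
  val : World′ → P → Bool
  val w p with any? (λ i → lookup Q i ≟ p)
  ... | yes (i , _) = bit w i
  ... | no _        = false

  literalᴾ : Bool → P → PL P
  literalᴾ b p = if b then atom p else (atom p ⇒ bot)

  char : World′ → PL P
  char w = foldr _∧_ (bot ⇒ bot)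
    (map (λ i → literalᴾ (bit w i) (lookup Q i)) (allFin (length Q)))

  ⌜literalᴾ⌝ : ∀ b p → ⌜ literalᴾ b p ⌝ ≡ literal b (atom p)
  ⌜literalᴾ⌝ true  p = refl
  ⌜literalᴾ⌝ false p = refl

  ⌜char⌝ : ∀ w → ⌜ char w ⌝ ≡
           ⋀ (map (λ i → literal (bit w i) (atom (lookup Q i))) (allFin (length Q)))
  ⌜char⌝ w = go (allFin (length Q))
    where
    go : ∀ is → ⌜ foldr _∧_ (bot ⇒ bot) (map (λ i → literalᴾ (bit w i) (lookup Q i)) is) ⌝ ≡
                ⋀ (map (λ i → literal (bit w i) (atom (lookup Q i))) is)
    go []       = refl
    go (i ∷ is) = cong₂ _∧_ (⌜literalᴾ⌝ (bit w i) (lookup Q i)) (go is)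

  open Finite val
  open Decision char

  -- The `with` repeats the search made by `val`, so the conjunct extracted from `char w` belongs to
  -- the same occurrence of `p`.
  char-describes : ∀ {p} → p ∈ˡ Q → Describes p
  char-describes {p} p∈Q w with any? (λ i → lookup Q i ≟ p)
  ... | yes (i , refl) = subst (_⊩ literal (bit w i) (atom p)) (sym (⌜char⌝ w))
    (⋀-elim (λ i → literal (bit w i) (atom (lookup Q i))) (∈-allFin i))
  ... | no none = contradiction (index p∈Q , sym (lookup-index p∈Q)) none

  -- Deciding the letter at each position yields a set `Y` of positions, whose indicator function
  -- encodes the world `w`.
  char-cases : (∀ w → ψ ∧ ⌜ char w ⌝ ⊩ φ) → ψ ⊩ φ
  char-cases {ψ = ψ} {φ = φ} h = case-all (λ i → atom (lookup Q i)) λ Y {γ′} base pos neg →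
    let
      w = encode (λ i → does (i ∈? Y))

      lit : ∀ i → γ′ ⊩ literal (bit w i) (atom (lookup Q i))
      lit = λ i → subst (λ b → γ′ ⊩ literal b (atom (lookup Q i)))
        (sym (bit-encode _ i)) (decided Y pos neg i)
    in h w ∙ ⟨ base , subst (γ′ ⊩_) (sym (⌜char⌝ w))
      (⋀-intro (λ i → literal (bit w i) (atom (lookup Q i))) (allFin (length Q)) (λ {i} _ → lit i)) ⟩
    where
    decided : ∀ Y {γ′} → (∀ {i} → i ∈ Y → γ′ ⊩ atom (lookup Q i)) →
              (∀ {i} → i ∉ Y → γ′ ⊩ ~ atom (lookup Q i)) →
              ∀ i → γ′ ⊩ literal (does (i ∈? Y)) (atom (lookup Q i))
    decided Y pos neg i with i ∈? Y
    ... | yes i∈Y = pos i∈Y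
    ... | no i∉Y  = neg i∉Y

theorem43 : (P : Set) → Countable P → (φ : DELKh P) →
    (∀ (M : Model P) (w : World M) → M , w ⊨ φ) →
    ⊢ φ
theorem43 P countable φ = complete char-cases φ (All.tabulate char-describes)
  where
  -- Countability supplies decidable equality of letters, pulled back from the natural numbers.
  open Valuations (via-injection countable _≟ℕ_) (lettersᴰ φ)
  open Finite val
  open Decision char
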